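{- Let $G$ be a connected graph. Then $G$ is a vertex-stable equimatchable graph if and only if $G$ is a complete graph, or a complete bipartite graph, or a bipartite edge-stable equimatchable graph.
   Context: All graphs are finite and simple. A graph is equimatchable if all its maximal matchings have the same cardinality. A graph $G$ is vertex-stable equimatchable if $G$ is equimatchable and $G-v$ is equimatchable for every $v\in V(G)$. An equimatchable graph $G$ is edge-stable if $G\setminus e$ (delete edge $e$, keep vertices) is equimatchable for every $e\in E(G)$. -}

module Defs where

open import Data.Bool.Base using (Bool)
open import Data.Fin.Base using (Fin; punchIn)
open import Data.Fin.Properties using (_≟_)
open import Data.List.Base using (List; length)
open import Data.List.Relation.Binary.Subset.Propositional using (_⊆_)
open import Data.List.Relation.Unary.All using (All)
open import Data.List.Relation.Unary.AllPairs using (AllPairs)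
open import Data.Nat.Base using (ℕ; suc; pred)
open import Data.Product.Base using (_×_; _,_; ∃; uncurry)
open import Data.Sum.Base using (_⊎_; inj₁; inj₂)
open import Function.Bundles using (_⇔_)
open import Level using (0ℓ)
open import Relation.Binary.Construct.Closure.ReflexiveTransitive using (Star)
open import Relation.Binary.Core using (Rel)
open import Relation.Binary.Definitions using (Decidable; Symmetric; Irreflexive)
open import Relation.Binary.PropositionalEquality using (_≡_; _≢_; cong)
open import Relation.Nullary using (¬_; ¬?; _×-dec_; _⊎-dec_)

record Graph (n : ℕ) : Set₁ where
  infix 4 _~_ _~?_
  field
    _~_      : Rel (Fin n) 0ℓ
    _~?_     : Decidable _~_
    ~-sym    : Symmetric _~_
    ~-irrefl : Irreflexive _≡_ _~_

open Graph

-- The vertices other than v are renumbered by the order-preserving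
-- bijection punchIn v : Fin n → Fin (suc n) ∖ {v}.
deleteVertex : ∀ {n} → Graph n → Fin n → Graph (pred n)
deleteVertex {suc n} G v = record
  { _~_      = λ x y → _~_ G (punchIn v x) (punchIn v y)
  ; _~?_     = λ x y → _~?_ G (punchIn v x) (punchIn v y)
  ; ~-sym    = ~-sym G
  ; ~-irrefl = λ x≡y → ~-irrefl G (cong (punchIn v) x≡y)
  }

SameEdge : ∀ {n} → Rel (Fin n × Fin n) 0ℓ
SameEdge (a , b) (c , d) = (a ≡ c × b ≡ d) ⊎ (a ≡ d × b ≡ c)

deleteEdge : ∀ {n} → Graph n → Fin n × Fin n → Graph n
deleteEdge G (u , v) = record
  { _~_      = λ x y → _~_ G x y × ¬ SameEdge (x , y) (u , v)
  ; _~?_     = λ x y → _~?_ G x y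
                 ×-dec ¬? ((x ≟ u ×-dec y ≟ v) ⊎-dec (x ≟ v ×-dec y ≟ u))
  ; ~-sym    = λ (x~y , xy≠uv) → ~-sym G x~y ,
                 λ { (inj₁ (y≡u , x≡v)) → xy≠uv (inj₂ (x≡v , y≡u))
                   ; (inj₂ (y≡v , x≡u)) → xy≠uv (inj₁ (x≡u , y≡v)) }
  ; ~-irrefl = λ x≡y (x~y , _) → ~-irrefl G x≡y x~y
  }

DisjointEdges : ∀ {n} → Rel (Fin n × Fin n) 0ℓ
DisjointEdges (a , b) (c , d) = a ≢ c × a ≢ d × b ≢ c × b ≢ d

-- A set of edges is a list of pairs, each edge being listed in one of its two
-- orientations.  Pairwise disjointness rules out listing an edge twice, so the
-- cardinality of a matching is the length of the list.
IsMatching : ∀ {n} → Graph n → List (Fin n × Fin n) → Set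
IsMatching G M = All (uncurry (_~_ G)) M × AllPairs DisjointEdges M

-- Inclusion of the lists of oriented pairs suffices: a matching containing M
-- as a set of edges can be reoriented to agree with M.
IsMaximalMatching : ∀ {n} → Graph n → List (Fin n × Fin n) → Set
IsMaximalMatching G M =
  IsMatching G M × (∀ N → IsMatching G N → M ⊆ N → N ⊆ M)

Equimatchable : ∀ {n} → Graph n → Set
Equimatchable G =
  ∀ M N → IsMaximalMatching G M → IsMaximalMatching G N → length M ≡ length N

VertexStableEquimatchable : ∀ {n} → Graph n → Set
VertexStableEquimatchable G =
  Equimatchable G × (∀ v → Equimatchable (deleteVertex G v))

EdgeStableEquimatchable : ∀ {n} → Graph n → Set
EdgeStableEquimatchable G =
  Equimatchable G × (∀ u v → _~_ G u v → Equimatchable (deleteEdge G (u , v)))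

-- The graph without vertices counts as connected (and as complete).
Connected : ∀ {n} → Graph n → Set
Connected G = ∀ u v → Star (_~_ G) u v

Complete : ∀ {n} → Graph n → Set
Complete G = ∀ u v → u ≢ v → _~_ G u v

-- A bipartition is given by the indicator function of one of its classes.
Bipartite : ∀ {n} → Graph n → Set
Bipartite {n} G =
  ∃ λ (side : Fin n → Bool) → ∀ u v → _~_ G u v → side u ≢ side v

-- A class may be empty; for a connected graph this only admits graphs with at
-- most one vertex, which are complete.
CompleteBipartite : ∀ {n} → Graph n → Set
CompleteBipartite {n} G =
  ∃ λ (side : Fin n → Bool) → ∀ u v → _~_ G u v ⇔ side u ≢ side v

{-# OPTIONS --safe #-}

-- Call a vertex exposable if some maximal matching misses it, and write
-- c-b-a-d for a path, its ends c and d being distinct but possibly adjacent.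
--
-- A graph is equimatchable as soon as no maximal matching is augmented by a
-- path c-b-a-d with ab in the matching.  If the ends of every such path are
-- adjacent this is immediate, which covers complete and complete bipartite
-- graphs; if G is bipartite and edge-stable, such an augmentation in G - v
-- survives in G or in G minus an edge at v.
--
-- Conversely let G be vertex-stable.  Comparing matchings in G, in G - d and
-- in G minus an unmatched vertex shows that a path c-b-a-d with c and d
-- nonadjacent is induced, and that one of its ends, say c, has two neighbours
-- missed by a common maximal matching, so that c is not exposable.  Hence a
-- connected G containing a triangle is complete.  If G is triangle-free,
-- exposable vertices are pairwise nonadjacent, and a vertex which is not
-- exposable but has an exposable neighbour has only exposable neighbours.  So
-- either all such paths close up, and G is complete bipartite, or being
-- exposable is a bipartition of G; then every edge has an exposable end, which
-- by stability at that end gives edge-stability.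
module Submission where

open import Defs
open import Data.Bool.Base using (Bool; true; false; not)
open import Data.Bool.Properties using (¬-not; not-involutive)
open import Data.Empty using (⊥; ⊥-elim)
open import Data.Fin.Base using (Fin; zero; suc; punchIn)
open import Data.Fin.Properties
  using (_≟_; any?; punchInᵢ≢i; punchIn-injective; punchIn-punchOut)
open import Data.List.Base
  using (List; []; _∷_; _++_; length; map; allFin; cartesianProduct)
open import Data.List.Membership.Propositional using (_∈_; find)
open import Data.List.Membership.Propositional.Properties
  using (∈-allFin; ∈-cartesianProduct⁺)
open import Data.List.Properties using (length-map; length-++; ++-identityʳ)
open import Data.List.Relation.Binary.Permutation.Homogeneous using (prep; swap)
import Data.List.Relation.Binary.Permutation.Setoid as SetoidPermutation
import Data.List.Relation.Binary.Permutation.Setoid.Properties as SetoidPermutationProperties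
open import Data.List.Relation.Unary.All as All using (All; []; _∷_)
open import Data.List.Relation.Unary.All.Properties
  using (++⁻ˡ; ++⁻ʳ; map⁺; map⁻; ¬All⇒Any¬) renaming (++⁺ to All++)
open import Data.List.Relation.Unary.AllPairs using (AllPairs; []; _∷_)
open import Data.List.Relation.Unary.Any using (here; there)
open import Data.Nat.Base using (ℕ; zero; suc; _≤_; _<_; z≤n; s≤s)
open import Data.Nat.Properties
  using (suc-injective; ≤-refl; ≤-reflexive; ≤-trans; ≤-antisym; m≤n+m; <⇒≱; ≰⇒>)
open import Data.Product.Base as Product
  using (_×_; _,_; ∃; ∃₂; ∃-syntax; proj₁; proj₂)
open import Data.Sum.Base as Sum using (_⊎_; inj₁; inj₂; [_,_])
open import Function.Base using (_∘_; _$_)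
open import Function.Bundles using (_⇔_; mk⇔; Equivalence)
open import Level using (0ℓ)
open import Relation.Binary.Bundles using (Setoid)
open import Relation.Binary.Construct.Closure.ReflexiveTransitive using (Star; ε; _◅_)
open import Relation.Binary.PropositionalEquality
  using (_≡_; _≢_; refl; sym; trans; cong; subst; ≢-sym)
open import Relation.Nullary using (¬_; Dec; yes; no; does; ¬?; _×-dec_)
open import Relation.Nullary.Decidable.Core using (decidable-stable)

private
  variable
    n : ℕ

-- Edges and matchings up to orientation and order

Edge : ℕ → Set
Edge n = Fin n × Fin n

-- Permutations over this setoid may also reverse single edges, so `↭` identifies lists presenting
-- the same multiset of undirected edges.
edgeSetoid : ℕ → Setoid 0ℓ 0ℓ
edgeSetoid n = record
  { Carrier = Edge n
  ; _≈_ = SameEdge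
  ; isEquivalence = record
    { refl = inj₁ (refl , refl)
    ; sym = λ { (inj₁ (refl , refl)) → inj₁ (refl , refl)
              ; (inj₂ (refl , refl)) → inj₂ (refl , refl) }
    ; trans = λ { (inj₁ (refl , refl)) q → q
                ; (inj₂ (refl , refl)) (inj₁ (refl , refl)) → inj₂ (refl , refl)
                ; (inj₂ (refl , refl)) (inj₂ (refl , refl)) → inj₁ (refl , refl) }
    }
  }

module _ {n : ℕ} where
  open SetoidPermutation (edgeSetoid n) public
    using (_↭_; ↭-refl; ↭-sym; ↭-trans; ↭-prep; ↭-swap)
  open SetoidPermutationProperties (edgeSetoid n) public
    using (All-resp-↭; AllPairs-resp-↭; xs↭ys⇒|xs|≡|ys|; ↭-shift; ++⁺ˡ; ++⁺ʳ)

pattern same = inj₁ (refl , refl)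
pattern flip = inj₂ (refl , refl)

infix 4 _∉ᵥ_ _∉ᵥ?_

_∉ᵥ_ : Fin n → List (Edge n) → Set
u ∉ᵥ M = All (λ e → u ≢ proj₁ e × u ≢ proj₂ e) M

_∉ᵥ?_ : (u : Fin n) (M : List (Edge n)) → Dec (u ∉ᵥ M)
u ∉ᵥ? M = All.all? (λ e → ¬? (u ≟ proj₁ e) ×-dec ¬? (u ≟ proj₂ e)) M

-- Being maximal as a matching, phrased through the vertices left unmatched.
Max : Graph n → List (Edge n) → Set
Max G M = IsMatching G M × (∀ {s t} → Graph._~_ G s t → s ∉ᵥ M → t ∉ᵥ M → ⊥)

Equi : Graph n → Set
Equi G = ∀ M N → Max G M → Max G N → length M ≡ length N

∉ᵥ-resp-↭ : ∀ {u : Fin n} {M N} → M ↭ N → u ∉ᵥ M → u ∉ᵥ N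
∉ᵥ-resp-↭ = All-resp-↭ λ { same q → q ; flip (p , q) → q , p }

∉ᵥ⇒≢ : ∀ {u v : Fin n} {M} → u ∉ᵥ M → ¬ v ∉ᵥ M → u ≢ v
∉ᵥ⇒≢ u∉ v∈ refl = v∈ u∉

disjoint-sym : ∀ {e f : Edge n} → DisjointEdges e f → DisjointEdges f e
disjoint-sym (p , q , r , s) = ≢-sym p , ≢-sym r , ≢-sym q , ≢-sym s

mate : ∀ {u : Fin n} M → ¬ u ∉ᵥ M → ∃₂ λ v M′ → M ↭ (u , v) ∷ M′
mate {u = u} [] u∈ = ⊥-elim (u∈ [])
mate {u = u} ((a , b) ∷ M) u∈ with u ≟ a | u ≟ b
... | yes refl | _ = b , M , ↭-refl
... | no _ | yes refl = a , M , prep flip ↭-refl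
... | no u≢a | no u≢b with mate M (λ u∉ → u∈ ((u≢a , u≢b) ∷ u∉))
... | v , M′ , M↭ = v , (a , b) ∷ M′ , ↭-trans (↭-prep _ M↭) (↭-swap _ _ ↭-refl)

-- Extending matchings and comparing their lengths

module _ {n : ℕ} (G : Graph n) where
  open Graph G

  ~⇒≢ : ∀ {x y} → x ~ y → x ≢ y
  ~⇒≢ x~y refl = ~-irrefl refl x~y

  matching-resp-↭ : ∀ {M N} → M ↭ N → IsMatching G M → IsMatching G N
  matching-resp-↭ M↭N (es , ds) =
    All-resp-↭ (λ { same p → p ; flip p → ~-sym p }) M↭N es ,
    AllPairs-resp-↭ disjoint-sym
      ( (λ { same d → d ; flip (p , q , r , s) → q , p , s , r })
      , (λ { same d → d ; flip (p , q , r , s) → r , s , p , q })) M↭N ds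

  max-resp-↭ : ∀ {M N} → M ↭ N → Max G M → Max G N
  max-resp-↭ M↭N (m , max) = matching-resp-↭ M↭N m ,
    λ e s∉ t∉ → max e (∉ᵥ-resp-↭ (↭-sym M↭N) s∉) (∉ᵥ-resp-↭ (↭-sym M↭N) t∉)

  cons⁺ : ∀ {a b M} →
    a ~ b → a ∉ᵥ M → b ∉ᵥ M → IsMatching G M → IsMatching G ((a , b) ∷ M)
  cons⁺ a~b a∉ b∉ (es , ds) =
    a~b ∷ es , All.zipWith (λ ((p , q) , (r , s)) → p , q , r , s) (a∉ , b∉) ∷ ds

  cons⁻ : ∀ {a b M} → IsMatching G ((a , b) ∷ M) →
    a ~ b × a ∉ᵥ M × b ∉ᵥ M × IsMatching G M
  cons⁻ (e ∷ es , d ∷ ds) =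
    e , All.map (λ (p , q , _) → p , q) d , All.map (λ (_ , _ , p , q) → p , q) d , es , ds

  matching-++⁻ʳ : ∀ L {M} → IsMatching G (L ++ M) → IsMatching G M
  matching-++⁻ʳ [] m = m
  matching-++⁻ʳ (_ ∷ L) (_ ∷ es , _ ∷ ds) = matching-++⁻ʳ L (es , ds)

  freeEdge? : ∀ M → Dec (∃₂ λ s t → s ~ t × s ∉ᵥ M × t ∉ᵥ M)
  freeEdge? M = any? λ s → any? λ t → (s ~? t) ×-dec (s ∉ᵥ? M) ×-dec (t ∉ᵥ? M)

  -- A greedy scan of all ordered pairs: a pair rejected once stays blocked, as the matching only
  -- grows.
  extend : ∀ {M} → IsMatching G M → ∃ λ L → Max G (L ++ M)
  extend {M} m =
    let (L , m′ , max) = greedy (cartesianProduct (allFin n) (allFin n))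
    in L , m′ , λ {s} {t} → max (∈-cartesianProduct⁺ (∈-allFin s) (∈-allFin t))
    where
    greedy : ∀ es → ∃ λ L → IsMatching G (L ++ M) ×
      (∀ {s t} → (s , t) ∈ es → s ~ t → s ∉ᵥ (L ++ M) → t ∉ᵥ (L ++ M) → ⊥)
    greedy [] = [] , m , λ ()
    greedy ((s , t) ∷ es) with greedy es
    ... | L , m′ , max with (s ~? t) ×-dec (s ∉ᵥ? (L ++ M)) ×-dec (t ∉ᵥ? (L ++ M))
    ... | yes (s~t , s∉ , t∉) = (s , t) ∷ L , cons⁺ s~t s∉ t∉ m′ ,
      λ { (here refl) _ ((s≢s , _) ∷ _) → ⊥-elim (s≢s refl)
        ; (there p) e (_ ∷ s∉′) (_ ∷ t∉′) → max p e s∉′ t∉′ }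
    ... | no ¬free = L , m′ ,
      λ { (here refl) e s∉ t∉ → ¬free (e , s∉ , t∉) ; (there p) → max p }

  module _ (equi : Equi G) where

    too-long : ∀ {M N} → Max G M → IsMatching G N → length M < length N → ⊥
    too-long {M} {N} maxM m lt with extend m
    ... | L , max = <⇒≱ lt (≤-trans (m≤n+m (length N) (length L))
      (≤-reflexive (trans (sym (length-++ L)) (equi _ _ max maxM))))

    max-of-length : ∀ {M N} → Max G M → IsMatching G N → length N ≡ length M → Max G N
    max-of-length maxM m eq = m , λ e s∉ t∉ →
      too-long maxM (cons⁺ e s∉ t∉ m) (≤-reflexive (cong suc (sym eq)))

    extensible : ∀ {M N} → IsMatching G M → IsMatching G N → length M < length N →
      ∃₂ λ s t → s ~ t × s ∉ᵥ M × t ∉ᵥ M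
    extensible {M} m m′ lt = decidable-stable (freeEdge? M) λ ¬free →
      too-long (m , λ e s∉ t∉ → ¬free (_ , _ , e , s∉ , t∉)) m′ lt

  -- Equimatchability from the absence of short augmentations

  NoShortAugmentation : Set
  NoShortAugmentation = ∀ {K a b c d} → Max G ((a , b) ∷ K) → c ~ b → a ~ d → c ≢ d →
    c ∉ᵥ (a , b) ∷ K → d ∉ᵥ (a , b) ∷ K → ⊥

  pull : ∀ {e K} L → Max G (e ∷ L ++ K) → Max G (L ++ e ∷ K)
  pull L = max-resp-↭ (↭-sym (↭-shift L _))

  push : ∀ {e K} L → Max G (L ++ e ∷ K) → Max G (e ∷ L ++ K)
  push L = max-resp-↭ (↭-shift L _)

  module _ (noAug : NoShortAugmentation) where

    private
      -- When every edge meets `K`, `a`, `b` or `c`, all edges of `N` contain `a`, so there is at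
      -- most one. If `M` is empty, such an edge `at` yields the forbidden augmentation c-b-a-t.
      tail-length≤ : ∀ {K a b c} M N → a ≢ c →
        (∀ {s t} → s ~ t → s ∉ᵥ (a , b) ∷ (b , c) ∷ K → t ∉ᵥ (a , b) ∷ (b , c) ∷ K → ⊥) →
        Max G ((a , b) ∷ M ++ K) → Max G ((b , c) ∷ N ++ K) → length N ≤ length M
      tail-length≤ _ [] _ _ _ _ = z≤n
      tail-length≤ (_ ∷ _) (_ ∷ []) _ _ _ _ = s≤s z≤n
      tail-length≤ {K} {a} {b} {c} [] ((s , t) ∷ []) a≢c ¬free maxM (mN , _)
        with cons⁻ mN
      ... | b~c , (b≢s , b≢t) ∷ _ , (c≢s , c≢t) ∷ c∉ , mK with cons⁻ mK
      ... | s~t , s∉ , t∉ , _ with s ≟ a | t ≟ a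
      ... | yes refl | _ = ⊥-elim $ noAug maxM (~-sym b~c) s~t c≢t
        ((≢-sym a≢c , ≢-sym (~⇒≢ b~c)) ∷ c∉) ((≢-sym (~⇒≢ s~t) , ≢-sym b≢t) ∷ t∉)
      ... | no _ | yes refl = ⊥-elim $ noAug maxM (~-sym b~c) (~-sym s~t) c≢s
        ((≢-sym a≢c , ≢-sym (~⇒≢ b~c)) ∷ c∉) ((~⇒≢ s~t , ≢-sym b≢s) ∷ s∉)
      ... | no s≢a | no t≢a = ⊥-elim (¬free s~t
        ((s≢a , ≢-sym b≢s) ∷ (≢-sym b≢s , ≢-sym c≢s) ∷ s∉)
        ((t≢a , ≢-sym b≢t) ∷ (≢-sym b≢t , ≢-sym c≢t) ∷ t∉))
      tail-length≤ {K} {a} {b} {c} M ((s , t) ∷ (p , q) ∷ N) a≢c ¬free maxM (mN , _)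
        with cons⁻ mN
      ... | b~c , (b≢s , b≢t) ∷ (b≢p , b≢q) ∷ _ , (c≢s , c≢t) ∷ (c≢p , c≢q) ∷ _ , mN′
        with cons⁻ mN′
      ... | s~t , (s≢p , s≢q) ∷ s∉ , (t≢p , t≢q) ∷ t∉ , mN″ with cons⁻ mN″
      ... | p~q , p∉ , q∉ , _ = ⊥-elim (touch s~t (b≢s , c≢s) (b≢t , c≢t)
          (++⁻ʳ N s∉) (++⁻ʳ N t∉) λ a-st →
          touch p~q (b≢p , c≢p) (b≢q , c≢q) (++⁻ʳ N p∉) (++⁻ʳ N q∉) λ a-pq → clash a-st a-pq)
        where
        touch : ∀ {s t} → s ~ t → b ≢ s × c ≢ s → b ≢ t × c ≢ t → s ∉ᵥ K → t ∉ᵥ K →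
          ¬ ¬ (s ≡ a ⊎ t ≡ a)
        touch e (p , q) (r , u) s∉ t∉ ¬a = ¬free e
          ((¬a ∘ inj₁ , ≢-sym p) ∷ (≢-sym p , ≢-sym q) ∷ s∉)
          ((¬a ∘ inj₂ , ≢-sym r) ∷ (≢-sym r , ≢-sym u) ∷ t∉)
        clash : s ≡ a ⊎ t ≡ a → p ≡ a ⊎ q ≡ a → ⊥
        clash (inj₁ refl) (inj₁ refl) = s≢p refl
        clash (inj₁ refl) (inj₂ refl) = s≢q refl
        clash (inj₂ refl) (inj₁ refl) = t≢p refl
        clash (inj₂ refl) (inj₂ refl) = t≢q refl

      flipHead : ∀ {a b L} → Max G ((a , b) ∷ L) → Max G ((b , a) ∷ L)
      flipHead = max-resp-↭ (prep flip ↭-refl)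

      -- Induction on the number of edges outside the common part `K`. The first edge of `M` either
      -- lies in `N` too and moves to `K`, or meets an edge of `N` in one vertex; then `share` takes
      -- over, and its calls back compare matchings with one edge fewer outside the common part.
      equi-over : ∀ m K M N → length M ≡ m → Max G (M ++ K) → Max G (N ++ K) → length N ≡ m

      -- If some edge st misses K and a, b, c, then M and N are compared
      -- through matchings containing st; otherwise each of them has at most one edge.
      share : ∀ m K {a b c} M N → a ≢ c → length M ≡ m →
        Max G ((a , b) ∷ M ++ K) → Max G ((b , c) ∷ N ++ K) → length N ≡ m
      share m K {a} {b} {c} M N a≢c eq maxM maxN
        with freeEdge? ((a , b) ∷ (b , c) ∷ K)
      ... | yes (s , t , s~t , (s≢a , s≢b) ∷ (_ , s≢c) ∷ s∉ , (t≢a , t≢b) ∷ (_ , t≢c) ∷ t∉)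
        using (a~b , a∉ , b∉ , mK) ← cons⁻ (proj₁ maxM)
        using (b~c , b∉′ , c∉ , _) ← cons⁻ (proj₁ maxN)
        using m-st ← cons⁺ s~t s∉ t∉ (matching-++⁻ʳ M mK)
        using (P , maxP) ← extend (cons⁺ a~b
                ((≢-sym s≢a , ≢-sym t≢a) ∷ ++⁻ʳ M a∉) ((≢-sym s≢b , ≢-sym t≢b) ∷ ++⁻ʳ M b∉) m-st)
        using (Q , maxQ) ← extend (cons⁺ b~c
                ((≢-sym s≢b , ≢-sym t≢b) ∷ ++⁻ʳ M b∉) ((≢-sym s≢c , ≢-sym t≢c) ∷ ++⁻ʳ N c∉) m-st)
        = equi-over m ((b , c) ∷ K) ((s , t) ∷ Q) N
            (equi-over m ((s , t) ∷ K) ((a , b) ∷ P) ((b , c) ∷ Q)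
              (equi-over m ((a , b) ∷ K) M ((s , t) ∷ P) eq (pull M maxM)
                (max-resp-↭ (↭-trans (++-swap P) (↭-shift P _)) maxP))
              (push P maxP) (push Q maxQ))
            (max-resp-↭ (↭-trans (++-swap Q) (↭-shift Q _)) maxQ) (pull N maxN)
        where
        ++-swap : ∀ L {e f : Edge n} → L ++ e ∷ f ∷ K ↭ L ++ f ∷ e ∷ K
        ++-swap [] = ↭-swap _ _ ↭-refl
        ++-swap (_ ∷ L) = ↭-prep _ (++-swap L)
      ... | no ¬free = trans (≤-antisym
        (tail-length≤ M N a≢c (λ e s∉ t∉ → ¬free (_ , _ , e , s∉ , t∉)) maxM maxN)
        (tail-length≤ N M (≢-sym a≢c)
          (λ e s∉ t∉ → ¬free (_ , _ , e , turn s∉ , turn t∉))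
          (flipHead maxN) (flipHead maxM))) eq
        where
        turn : ∀ {s} → s ∉ᵥ (c , b) ∷ (b , a) ∷ K → s ∉ᵥ (a , b) ∷ (b , c) ∷ K
        turn ((p , q) ∷ (r , u) ∷ s∉) = (u , r) ∷ (q , p) ∷ s∉

      equi-over zero K [] [] _ _ _ = refl
      equi-over zero K [] ((s , t) ∷ N) _ (_ , max) (mN , _)
        using (s~t , s∉ , t∉ , _) ← cons⁻ mN
        = ⊥-elim (max s~t (++⁻ʳ N s∉) (++⁻ʳ N t∉))
      equi-over (suc m) K ((a , b) ∷ M) N eq maxM maxN
        using (a~b , a∉ , b∉ , mM) ← cons⁻ (proj₁ maxM)
        with a ∉ᵥ? N
      ... | no a∈ with mate N a∈
      ...   | c , N′ , N↭ with b ≟ c | max-resp-↭ (++⁺ʳ K N↭) maxN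
      ...     | yes refl | maxN′ = trans (xs↭ys⇒|xs|≡|ys| N↭)
        (cong suc (equi-over m _ M N′ (suc-injective eq) (pull M maxM) (pull N′ maxN′)))
      ...     | no b≢c | maxN′ = trans (xs↭ys⇒|xs|≡|ys| N↭)
        (cong suc (share m K M N′ b≢c (suc-injective eq) (flipHead maxM) maxN′))
      equi-over (suc m) K ((a , b) ∷ M) N eq maxM maxN
          | yes a∉N with b ∉ᵥ? N
      ... | yes b∉N = ⊥-elim (proj₂ maxN a~b (All++ a∉N (++⁻ʳ M a∉)) (All++ b∉N (++⁻ʳ M b∉)))
      ... | no b∈ with mate N b∈
      ...   | c , N′ , N↭ = trans (xs↭ys⇒|xs|≡|ys| N↭)
        (cong suc (share m K M N′ (proj₂ (All.head (∉ᵥ-resp-↭ N↭ a∉N))) (suc-injective eq)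
          maxM (max-resp-↭ (++⁺ʳ K N↭) maxN)))

    noShortAugmentation⇒equi : Equi G
    noShortAugmentation⇒equi M N maxM maxN = sym (equi-over (length M) [] M N refl
      (subst (Max G) (sym (++-identityʳ M)) maxM) (subst (Max G) (sym (++-identityʳ N)) maxN))

-- Agreement of the two notions of maximality

meeting-edges-equal : ∀ {M : List (Edge n)} {e f} → AllPairs DisjointEdges M → e ∈ M → f ∈ M →
  ¬ DisjointEdges e f → e ≡ f
meeting-edges-equal _ (here refl) (here refl) _ = refl
meeting-edges-equal (d ∷ _) (here refl) (there q) meet = ⊥-elim (meet (All.lookup d q))
meeting-edges-equal (d ∷ _) (there p) (here refl) meet =
  ⊥-elim (meet (disjoint-sym (All.lookup d p)))
meeting-edges-equal (_ ∷ ds) (there p) (there q) meet = meeting-edges-equal ds p q meet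

module _ {n : ℕ} (G : Graph n) where
  open Graph G

  maximal⇒max : ∀ {M} → IsMaximalMatching G M → Max G M
  maximal⇒max (m , maximal) = m , λ e s∉ t∉ →
    proj₁ (All.lookup s∉ (maximal _ (cons⁺ G e s∉ t∉ m) there (here refl))) refl

  -- An edge of `N` has an end covered by some edge of `M`. Both edges lie in `N` and meet, so they
  -- are the same pair, orientation included.
  max⇒maximal : ∀ {M} → Max G M → IsMaximalMatching G M
  max⇒maximal {M} (m , max) = m , λ N mN M⊆N → included mN M⊆N
    where
    included : ∀ {N} → IsMatching G N → (∀ {e} → e ∈ M → e ∈ N) → ∀ {e} → e ∈ N → e ∈ M
    included (es , ds) M⊆N {x , y} e∈N with x ∉ᵥ? M | y ∉ᵥ? M
    ... | yes x∉ | yes y∉ = ⊥-elim (max (All.lookup es e∈N) x∉ y∉)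
    ... | no x∈ | _ with find (¬All⇒Any¬ (λ e → ¬? (x ≟ proj₁ e) ×-dec ¬? (x ≟ proj₂ e)) M x∈)
    ...   | f , f∈M , meet = subst (_∈ M)
      (sym (meeting-edges-equal ds e∈N (M⊆N f∈M) λ (p , q , _) → meet (p , q))) f∈M
    included (es , ds) M⊆N {x , y} e∈N | yes _ | no y∈
        with find (¬All⇒Any¬ (λ e → ¬? (y ≟ proj₁ e) ×-dec ¬? (y ≟ proj₂ e)) M y∈)
    ...   | f , f∈M , meet = subst (_∈ M)
      (sym (meeting-edges-equal ds e∈N (M⊆N f∈M) λ (_ , _ , p , q) → meet (p , q))) f∈M

  equimatchable⇒equi : Equimatchable G → Equi G
  equimatchable⇒equi equi M N maxM maxN = equi M N (max⇒maximal maxM) (max⇒maximal maxN)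

  equi⇒equimatchable : Equi G → Equimatchable G
  equi⇒equimatchable equi M N maxM maxN = equi M N (maximal⇒max maxM) (maximal⇒max maxN)

-- Deleting a vertex versus isolating it

-- Unlike deleteVertex, this keeps the vertex set, so that matchings of G and
-- of G - v are lists of the same type.
isolate : Graph n → Fin n → Graph n
isolate G v = record
  { _~_      = λ x y → x ~ y × x ≢ v × y ≢ v
  ; _~?_     = λ x y → (x ~? y) ×-dec ¬? (x ≟ v) ×-dec ¬? (y ≟ v)
  ; ~-sym    = λ (e , p , q) → ~-sym e , q , p
  ; ~-irrefl = λ eq (e , _) → ~-irrefl eq e
  }
  where open Graph G

isolate-matching⁺ : ∀ (G : Graph n) {v M} →
  IsMatching G M → v ∉ᵥ M → IsMatching (isolate G v) M
isolate-matching⁺ G (es , ds) v∉ =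
  All.zipWith (λ (e , p , q) → e , ≢-sym p , ≢-sym q) (es , v∉) , ds

isolate-matching⁻ : ∀ (G : Graph n) {v M} →
  IsMatching (isolate G v) M → IsMatching G M × v ∉ᵥ M
isolate-matching⁻ G (es , ds) =
  (All.map proj₁ es , ds) , All.map (λ (_ , p , q) → ≢-sym p , ≢-sym q) es

module _ {n : ℕ} (G : Graph (suc n)) (v : Fin (suc n)) where
  private
    H = deleteVertex G v
    I = isolate G v
    embed : List (Edge n) → List (Edge (suc n))
    embed = map (Product.map (punchIn v) (punchIn v))

    ∉ᵥ-embed⁺ : ∀ {u M} → u ∉ᵥ M → punchIn v u ∉ᵥ embed M
    ∉ᵥ-embed⁺ = map⁺ ∘
      All.map (λ (p , q) → p ∘ punchIn-injective v _ _ , q ∘ punchIn-injective v _ _)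

    ∉ᵥ-embed⁻ : ∀ {u M} → punchIn v u ∉ᵥ embed M → u ∉ᵥ M
    ∉ᵥ-embed⁻ = All.map (λ (p , q) → p ∘ cong (punchIn v) , q ∘ cong (punchIn v)) ∘ map⁻

    matching-embed⁺ : ∀ M → IsMatching H M → IsMatching I (embed M)
    matching-embed⁺ [] _ = [] , []
    matching-embed⁺ (_ ∷ M) m with cons⁻ H m
    ... | e , p , q , m′ = cons⁺ I (e , punchInᵢ≢i v _ , punchInᵢ≢i v _)
      (∉ᵥ-embed⁺ p) (∉ᵥ-embed⁺ q) (matching-embed⁺ M m′)

    matching-embed⁻ : ∀ M → IsMatching I (embed M) → IsMatching H M
    matching-embed⁻ [] _ = [] , []
    matching-embed⁻ (_ ∷ M) m with cons⁻ I m
    ... | (e , _) , p , q , m′ = cons⁺ H e (∉ᵥ-embed⁻ p) (∉ᵥ-embed⁻ q) (matching-embed⁻ M m′)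

    embedded : ∀ {x} → x ≢ v → ∃ λ y → x ≡ punchIn v y
    embedded x≢v = _ , sym (punchIn-punchOut (≢-sym x≢v))

    restrict : ∀ M → IsMatching I M → ∃ λ M′ → M ≡ embed M′
    restrict [] _ = [] , refl
    restrict (_ ∷ M) m with cons⁻ I m
    ... | (_ , x≢v , y≢v) , _ , _ , m′ with embedded x≢v | embedded y≢v | restrict M m′
    ... | x , refl | y , refl | M′ , refl = (x , y) ∷ M′ , refl

    max-embed⁺ : ∀ {M} → Max H M → Max I (embed M)
    max-embed⁺ {M} (m , max) = matching-embed⁺ M m , λ e s∉ t∉ → max′ e s∉ t∉
      where
      max′ : ∀ {s t} → Graph._~_ I s t → s ∉ᵥ embed M → t ∉ᵥ embed M → ⊥
      max′ (e , s≢v , t≢v) s∉ t∉ with embedded s≢v | embedded t≢v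
      ... | _ , refl | _ , refl = max e (∉ᵥ-embed⁻ s∉) (∉ᵥ-embed⁻ t∉)

    max-embed⁻ : ∀ {M} → Max I (embed M) → Max H M
    max-embed⁻ {M} (m , max) = matching-embed⁻ M m , λ e s∉ t∉ →
      max (e , punchInᵢ≢i v _ , punchInᵢ≢i v _) (∉ᵥ-embed⁺ s∉) (∉ᵥ-embed⁺ t∉)

  deleteVertex⇒isolate : Equi H → Equi I
  deleteVertex⇒isolate equi M N maxM maxN
    with restrict M (proj₁ maxM) | restrict N (proj₁ maxN)
  ... | M′ , refl | N′ , refl = trans (length-map _ M′)
    (trans (equi M′ N′ (max-embed⁻ maxM) (max-embed⁻ maxN)) (sym (length-map _ N′)))

  isolate⇒deleteVertex : Equi I → Equi H
  isolate⇒deleteVertex equi M N maxM maxN = trans (sym (length-map _ M))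
    (trans (equi (embed M) (embed N) (max-embed⁺ maxM) (max-embed⁺ maxN)) (length-map _ N))

VertexStable : Graph n → Set
VertexStable G = Equi G × (∀ v → Equi (isolate G v))

vertexStable⁺ : ∀ (G : Graph n) → VertexStableEquimatchable G → VertexStable G
vertexStable⁺ {zero} G (equi , _) = equimatchable⇒equi G equi , λ ()
vertexStable⁺ {suc n} G (equi , stable) = equimatchable⇒equi G equi ,
  λ v → deleteVertex⇒isolate G v (equimatchable⇒equi (deleteVertex G v) (stable v))

vertexStable⁻ : ∀ (G : Graph n) → VertexStable G → VertexStableEquimatchable G
vertexStable⁻ {zero} G (equi , _) = equi⇒equimatchable G equi , λ ()
vertexStable⁻ {suc n} G (equi , stable) = equi⇒equimatchable G equi ,
  λ v → equi⇒equimatchable (deleteVertex G v) (isolate⇒deleteVertex G v (stable v))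

-- Graphs whose four-vertex paths close up

-- Equivalently, no four vertices induce a path, a paw or a diamond.
P₄Closed : Graph n → Set
P₄Closed G = ∀ {c b a d} → c ~ b → b ~ a → a ~ d → c ≢ a → b ≢ d → c ≢ d → c ~ d
  where open Graph G

p₄Closed⇒equi : ∀ (G : Graph n) → P₄Closed G → Equi G
p₄Closed⇒equi G closed = noShortAugmentation⇒equi G
  λ { (m , max) c~b a~d c≢d c∉@((c≢a , _) ∷ _) d∉@((_ , d≢b) ∷ _) →
      max (closed c~b (Graph.~-sym G (proj₁ (cons⁻ G m))) a~d c≢a (≢-sym d≢b) c≢d) c∉ d∉ }

-- Isolating `v` preserves the property, since a closing edge joins two path ends other than `v`.
p₄Closed⇒vertexStable : ∀ (G : Graph n) → P₄Closed G → VertexStable G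
p₄Closed⇒vertexStable G closed = p₄Closed⇒equi G closed , λ v →
  p₄Closed⇒equi (isolate G v) λ (p , c≢v , _) (q , _) (r , _ , d≢v) c≢a b≢d c≢d →
    closed p q r c≢a b≢d c≢d , c≢v , d≢v

module _ {n : ℕ} (G : Graph n) where
  open Graph G

  complete⇒p₄Closed : Complete G → P₄Closed G
  complete⇒p₄Closed complete _ _ _ _ _ c≢d = complete _ _ c≢d

  -- The ends of a walk of three edges lie in opposite classes.
  completeBipartite⇒p₄Closed : CompleteBipartite G → P₄Closed G
  completeBipartite⇒p₄Closed (side , bip) {c} {b} {a} {d} c~b b~a a~d _ _ _ =
    from λ eq → to c~b (trans eq (sym (trans
      (¬-not (to b~a)) (trans (cong not (¬-not (to a~d))) (not-involutive _)))))
    where open module E {u v} = Equivalence (bip u v)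

  -- Bipartite edge-stable graphs are vertex-stable

  deleteEdge-matching : ∀ {u v M} → IsMatching G M → u ∉ᵥ M →
    IsMatching (deleteEdge G (u , v)) M
  deleteEdge-matching (es , ds) u∉ = All.zipWith
    (λ (e , p , q) → e , λ { (inj₁ (eq , _)) → p (sym eq) ; (inj₂ (_ , eq)) → q (sym eq) })
    (es , u∉) , ds

  module _ (equi : Equi G) (bip : Bipartite G)
    (stable : ∀ u v → u ~ v → Equi (deleteEdge G (u , v))) where

    private
      side = proj₁ bip

      -- The parameters describe a matching of `G` that is maximal once `v` is removed, and a path
      -- c-b-a-d avoiding `v` that augments it. The aim is to exclude every unmatched neighbour `z`
      -- of `v`.
      module _ {v K a b c d} (v∉ : v ∉ᵥ (a , b) ∷ K)
        (m : IsMatching G ((a , b) ∷ K))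
        (max : ∀ {s t} → s ~ t → s ≢ v → t ≢ v → s ∉ᵥ (a , b) ∷ K → t ∉ᵥ (a , b) ∷ K → ⊥)
        (c~b : c ~ b) (a~d : a ~ d) (c≢d : c ≢ d) (c≢v : c ≢ v) (d≢v : d ≢ v)
        (c∉ : c ∉ᵥ (a , b) ∷ K) (d∉ : d ∉ᵥ (a , b) ∷ K) where

        longer : IsMatching G ((c , b) ∷ (a , d) ∷ K)
        longer =
          let (a~b , a∉ , b∉ , mK) = cons⁻ G m
              (c≢a , c≢b) = All.head c∉
              (_ , d≢b) = All.head d∉
          in cons⁺ G c~b ((c≢a , c≢d) ∷ All.tail c∉) ((≢-sym (~⇒≢ G a~b) , ≢-sym d≢b) ∷ b∉)
            (cons⁺ G a~d a∉ (All.tail d∉) mK)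

        v∉longer : v ∉ᵥ (c , b) ∷ (a , d) ∷ K
        v∉longer = let (v≢a , v≢b) = All.head v∉ in
          (≢-sym c≢v , v≢b) ∷ (v≢a , ≢-sym d≢v) ∷ All.tail v∉

        max-with : ∀ {z} → v ~ z → z ∉ᵥ (a , b) ∷ K → Max G ((v , z) ∷ (a , b) ∷ K)
        max-with v~z z∉ = cons⁺ G v~z v∉ z∉ m ,
          λ { e ((s≢v , _) ∷ s∉) ((t≢v , _) ∷ t∉) → max e s≢v t≢v s∉ t∉ }

        -- Adding `vz` makes the matching maximal in `G`, yet `vz` can be added to `longer` as well.
        neighbour : ∀ {z} → v ~ z → z ∉ᵥ (a , b) ∷ K → z ≢ c → z ≢ d → ⊥
        neighbour v~z z∉@((z≢a , z≢b) ∷ z∉K) z≢c z≢d =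
          too-long G equi (max-with v~z z∉)
            (cons⁺ G v~z v∉longer ((z≢c , z≢b) ∷ (z≢a , z≢d) ∷ z∉K) longer) ≤-refl

        -- Three edges lead from `c` to `d`, which puts them in opposite classes, whereas neighbours
        -- of `v` share a class.
        opposite : v ~ c → v ~ d → ⊥
        opposite v~c v~d = sides (¬-not (proj₂ bip _ _ v~c)) (¬-not (proj₂ bip _ _ v~d))
          (¬-not (proj₂ bip _ _ c~b)) (¬-not (proj₂ bip _ _ (proj₁ (cons⁻ G m))))
          (proj₂ bip _ _ a~d)
          where
          sides : ∀ {v a b c d} → v ≡ not c → v ≡ not d → c ≡ not b → a ≡ not b → a ≢ d → ⊥
          sides {c = true} {d = true} refl refl p q r = r (trans q (sym p))
          sides {c = false} {d = false} refl refl p q r = r (trans q (sym p))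

        -- As `c` is now the only unmatched neighbour of `v`, deleting the edge `vc` makes the
        -- matching maximal, while `longer` survives the deletion because it misses `v`.
        attached : v ~ c → ⊥
        attached v~c = too-long (deleteEdge G (v , c)) (stable v c v~c)
          (deleteEdge-matching m v∉ , maxDel) (deleteEdge-matching longer v∉longer) ≤-refl
          where
          only : ∀ {z} → v ~ z → z ∉ᵥ (a , b) ∷ K → z ≡ c
          only {z} v~z z∉ with z ≟ c | z ≟ d
          ... | yes eq | _ = eq
          ... | no _ | yes refl = ⊥-elim (opposite v~c v~z)
          ... | no z≢c | no z≢d = ⊥-elim (neighbour v~z z∉ z≢c z≢d)
          maxDel : ∀ {s t} → Graph._~_ (deleteEdge G (v , c)) s t →
            s ∉ᵥ (a , b) ∷ K → t ∉ᵥ (a , b) ∷ K → ⊥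
          maxDel {s} {t} (s~t , ≢vc) s∉ t∉ with s ≟ v | t ≟ v
          ... | yes refl | _ = ≢vc (inj₁ (refl , only s~t t∉))
          ... | no _ | yes refl = ≢vc (inj₂ (only (~-sym s~t) s∉ , refl))
          ... | no s≢v | no t≢v = max s~t s≢v t≢v s∉ t∉

    bipartite-edgeStable⇒equi-isolate : ∀ v → Equi (isolate G v)
    bipartite-edgeStable⇒equi-isolate v = noShortAugmentation⇒equi (isolate G v) noAug
      where
      noAug : NoShortAugmentation (isolate G v)
      noAug {K} {a} {b} {c} {d} (mI , maxI) (c~b , c≢v , _) (a~d , _ , d≢v) c≢d c∉ d∉
        using (m , v∉) ← isolate-matching⁻ G mI
        with freeEdge? G ((a , b) ∷ K)
      ... | no ¬free = too-long G equi (m , λ e s∉ t∉ → ¬free (_ , _ , e , s∉ , t∉))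
        (longer v∉ m (λ e p q → maxI (e , p , q)) c~b a~d c≢d c≢v d≢v c∉ d∉) ≤-refl
      ... | yes (s , t , s~t , s∉ , t∉) = conclude
        where
        max : ∀ {s t} → s ~ t → s ≢ v → t ≢ v → s ∉ᵥ (a , b) ∷ K → t ∉ᵥ (a , b) ∷ K → ⊥
        max e p q = maxI (e , p , q)
        turn : ∀ {z} → z ∉ᵥ (a , b) ∷ K → z ∉ᵥ (b , a) ∷ K
        turn = ∉ᵥ-resp-↭ (prep flip ↭-refl)
        ends : ∀ {z} → v ~ z → z ∉ᵥ (a , b) ∷ K → ⊥
        ends {z} v~z z∉ with z ≟ c | z ≟ d
        ... | yes refl | _ = attached v∉ m max c~b a~d c≢d c≢v d≢v c∉ d∉ v~z
        -- The case of `d` is that of `c` for the reversed path d-a-b-c.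
        ... | no _ | yes refl = attached (turn v∉) (matching-resp-↭ G (prep flip ↭-refl) m)
          (λ e p q s∉ t∉ → max e p q
            (∉ᵥ-resp-↭ (prep flip ↭-refl) s∉) (∉ᵥ-resp-↭ (prep flip ↭-refl) t∉))
          (~-sym a~d) (~-sym c~b) (≢-sym c≢d) d≢v c≢v (turn d∉) (turn c∉) v~z
        ... | no z≢c | no z≢d = neighbour v∉ m max c~b a~d c≢d c≢v d≢v c∉ d∉ v~z z∉ z≢c z≢d
        conclude : ⊥
        conclude with s ≟ v | t ≟ v
        ... | yes refl | _ = ends s~t t∉
        ... | no _ | yes refl = ends (~-sym s~t) s∉
        ... | no s≢v | no t≢v = max s~t s≢v t≢v s∉ t∉

-- Exposable vertices and alternating paths

mate-in-tail : ∀ {u : Fin n} K M → u ∉ᵥ K → ¬ u ∉ᵥ K ++ M →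
  ∃₂ λ v M′ → K ++ M ↭ (u , v) ∷ K ++ M′ × length M ≡ suc (length M′)
mate-in-tail K M u∉ u∈ with mate M (u∈ ∘ All++ u∉)
... | v , M′ , M↭ =
  v , M′ , ↭-trans (++⁺ˡ K M↭) (↭-shift K M′) , xs↭ys⇒|xs|≡|ys| M↭

module _ {n : ℕ} (G : Graph n) where
  open Graph G

  Exposable : Fin n → Set
  Exposable v = ∃ λ M → Max G M × v ∉ᵥ M

  module _ (equi : Equi G) where

    -- Trading `ab` for `bc` keeps the number of edges, which in an equimatchable graph already
    -- guarantees maximality.
    rotate : ∀ {M a b c} → Max G ((a , b) ∷ M) → b ~ c → c ∉ᵥ (a , b) ∷ M →
      Max G ((b , c) ∷ M) × a ∉ᵥ (b , c) ∷ M
    rotate max@(m , _) b~c ((c≢a , _) ∷ c∉) with cons⁻ G m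
    ... | a~b , a∉ , b∉ , m′ =
      max-of-length G equi max (cons⁺ G b~c b∉ c∉ m′) refl , (~⇒≢ G a~b , ≢-sym c≢a) ∷ a∉

    -- K collects the edges already common to both matchings: they are kept, so
    -- that the recursive call only changes the remaining edges.
    exchange : ∀ k K M N {m z₁ z₂} → length M ≡ k → Max G (K ++ M) → Max G (K ++ N) →
      z₁ ≢ z₂ → z₁ ∉ᵥ K ++ M → z₂ ∉ᵥ K ++ M → m ∉ᵥ K ++ N →
      ∃ λ L → Max G (K ++ L) × m ∉ᵥ K ++ L × (z₁ ∉ᵥ K ++ L ⊎ z₂ ∉ᵥ K ++ L)
    exchange k K M N {m} {z₁} {z₂} eq maxM maxN z₁≢z₂ z₁∉ z₂∉ m∉N with m ∉ᵥ? K ++ M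
    ... | yes m∉ = M , maxM , m∉ , inj₁ z₁∉
    ... | no m∈ with mate-in-tail K M (++⁻ˡ K m∉N) m∈
    ... | m₁ , M′ , M↭ , lenM with cons⁻ G (proj₁ (max-resp-↭ G M↭ maxM))
    ... | m~m₁ , _ , m₁∉M′ , _ with m₁ ∉ᵥ? K ++ N
    ... | yes m₁∉N = ⊥-elim (proj₂ maxN m~m₁ m∉N m₁∉N)
    ... | no m₁∈N with mate-in-tail K N (++⁻ˡ K m₁∉M′) m₁∈N
    ... | m₂ , N′ , N↭ , _ with cons⁻ G (proj₁ (max-resp-↭ G N↭ maxN)) | m₂ ∉ᵥ? K ++ M
    -- The alternating path ends at `m₂`; rotating covers only this new vertex, hence at most one of
    -- `z₁` and `z₂`.
    ... | m₁~m₂ , _ | yes m₂∉ = rotated (z₁ ≟ m₂)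
      where
      off : ∀ {z} → z ≢ m₂ → z ∉ᵥ K ++ M → z ∉ᵥ K ++ (m₁ , m₂) ∷ M′
      off z≢m₂ z∉ with ∉ᵥ-resp-↭ M↭ z∉
      ... | (_ , z≢m₁) ∷ z∉′ = ∉ᵥ-resp-↭ (↭-sym (↭-shift K M′)) ((z≢m₁ , z≢m₂) ∷ z∉′)
      rotated : Dec (z₁ ≡ m₂) → _
      rotated z₁≟m₂ with rotate (max-resp-↭ G M↭ maxM) m₁~m₂ (∉ᵥ-resp-↭ M↭ m₂∉)
      ... | max′ , m∉ = (m₁ , m₂) ∷ M′ , max-resp-↭ G (↭-sym (↭-shift K M′)) max′ ,
        ∉ᵥ-resp-↭ (↭-sym (↭-shift K M′)) m∉ , choose z₁≟m₂
        where
        choose : Dec (z₁ ≡ m₂) → _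
        choose (yes refl) = inj₂ (off (≢-sym z₁≢z₂) z₂∉)
        choose (no z₁≢m₂) = inj₁ (off z₁≢m₂ z₁∉)
    exchange k K M N {m} {z₁} {z₂} eq maxM maxN z₁≢z₂ z₁∉ z₂∉ m∉N | no m∈
      | m₁ , M′ , M↭ , lenM | m~m₁ , _ , m₁∉M′ , _ | no m₁∈N
      | m₂ , N′ , N↭ , _ | m₁~m₂ , m₁∉N′ , m₂∉N′ , mN′ | no m₂∈ with k | trans (sym lenM) eq
    ... | suc k′ | eq′ with ∉ᵥ-resp-↭ N↭ m∉N
    ... | (m≢m₁ , m≢m₂) ∷ m∉N′
      with exchange k′ ((m , m₁) ∷ K) M′ N′ (suc-injective eq′) (max-resp-↭ G M↭ maxM)
        (max-of-length G equi (max-resp-↭ G N↭ maxN) (cons⁺ G m~m₁ m∉N′ m₁∉N′ mN′) refl)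
        z₁≢z₂ (∉ᵥ-resp-↭ M↭ z₁∉) (∉ᵥ-resp-↭ M↭ z₂∉)
        ((≢-sym m≢m₂ , ≢-sym (~⇒≢ G m₁~m₂)) ∷ m₂∉N′)
    -- Trading `mm₁` for `m₁m₂` exposes `m` at the cost of `m₂`, which is neither `z₁` nor `z₂`
    -- because `K ++ M` covers it.
    ... | L , maxL , m₂∉L , z∉ with rotate maxL m₁~m₂ m₂∉L
    ... | max′ , m∉ = (m₁ , m₂) ∷ L , max-resp-↭ G (↭-sym (↭-shift K L)) max′ ,
      ∉ᵥ-resp-↭ (↭-sym (↭-shift K L)) m∉ ,
      Sum.map (off (∉ᵥ⇒≢ z₁∉ m₂∈)) (off (∉ᵥ⇒≢ z₂∉ m₂∈)) z∉
      where
      off : ∀ {z} → z ≢ m₂ → z ∉ᵥ (m , m₁) ∷ K ++ L → z ∉ᵥ K ++ (m₁ , m₂) ∷ L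
      off z≢m₂ ((_ , z≢m₁) ∷ z∉) = ∉ᵥ-resp-↭ (↭-sym (↭-shift K L)) ((z≢m₁ , z≢m₂) ∷ z∉)

    -- Exposing `c` by `exchange` would leave one of its neighbours `z₁`, `z₂` unmatched too, so an
    -- edge could be added.
    two-unmatched⇒¬exposable : ∀ {M c z₁ z₂} → Max G M → z₁ ≢ z₂ → c ~ z₁ → c ~ z₂ →
      z₁ ∉ᵥ M → z₂ ∉ᵥ M → ¬ Exposable c
    two-unmatched⇒¬exposable {M} maxM z₁≢z₂ c~z₁ c~z₂ z₁∉ z₂∉ (N , maxN , c∉)
      with exchange _ [] M N refl maxM maxN z₁≢z₂ z₁∉ z₂∉ c∉
    ... | L , maxL , c∉L , inj₁ z₁∉L = proj₂ maxL c~z₁ c∉L z₁∉L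
    ... | L , maxL , c∉L , inj₂ z₂∉L = proj₂ maxL c~z₂ c∉L z₂∉L

  -- Open paths in vertex-stable graphs

  module _ (stable : VertexStable G) where

    private
      equi = proj₁ stable

    -- c is the vertex of the path c-b-a-d seeing two unmatched vertices at once.
    Tip : Fin n → Fin n → Fin n → Fin n → Set
    Tip c b a d = ¬ c ~ a × ¬ b ~ d × ∃ Exposable × ¬ Exposable c

    module _ {c b a d K} (max : Max G ((c , b) ∷ (a , d) ∷ K)) (b~a : b ~ a) (c≁d : ¬ c ~ d) where

      private
        M : List (Edge n)
        M = (c , b) ∷ (a , d) ∷ K
        m₁ = cons⁻ G (proj₁ max)
        m₂ = cons⁻ G (proj₂ (proj₂ (proj₂ m₁)))
        mK = proj₂ (proj₂ (proj₂ m₂))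
        c~b = proj₁ m₁
        a~d = proj₁ m₂
        c∉ = All.tail (proj₁ (proj₂ m₁))
        b∉ = All.tail (proj₁ (proj₂ (proj₂ m₁)))
        a∉ = proj₁ (proj₂ m₂)
        d∉ = proj₁ (proj₂ (proj₂ m₂))
        c≢a = proj₁ (All.head (proj₁ (proj₂ m₁)))
        c≢d = proj₂ (All.head (proj₁ (proj₂ m₁)))
        b≢d = proj₂ (All.head (proj₁ (proj₂ (proj₂ m₁))))
        c≢b = ~⇒≢ G c~b
        b≢a = ~⇒≢ G b~a
        a≢d = ~⇒≢ G a~d

        mab : IsMatching G ((a , b) ∷ K)
        mab = cons⁺ G (~-sym b~a) a∉ b∉ mK

      -- Since `M` is maximal, `st` contains `c` or `d`, and not both because they are nonadjacent;
      -- `z` is its other end.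
      outlet : ∀ {s t} → s ~ t → s ∉ᵥ (a , b) ∷ K → t ∉ᵥ (a , b) ∷ K →
        ∃ λ z → (z ≡ s ⊎ z ≡ t) × z ∉ᵥ M × (c ~ z ⊎ d ~ z)
      outlet {s} {t} s~t ((s≢a , s≢b) ∷ s∉) ((t≢a , t≢b) ∷ t∉)
        with s ≟ c | s ≟ d | t ≟ c | t ≟ d
      ... | yes refl | _ | _ | yes refl = ⊥-elim (c≁d s~t)
      ... | yes refl | _ | _ | no t≢d = t , inj₂ refl ,
        (≢-sym (~⇒≢ G s~t) , t≢b) ∷ (t≢a , t≢d) ∷ t∉ , inj₁ s~t
      ... | no _ | yes refl | yes refl | _ = ⊥-elim (c≁d (~-sym s~t))
      ... | no _ | yes refl | no t≢c | _ = t , inj₂ refl ,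
        (t≢c , t≢b) ∷ (t≢a , ≢-sym (~⇒≢ G s~t)) ∷ t∉ , inj₂ s~t
      ... | no s≢c | no s≢d | yes refl | _ = s , inj₁ refl ,
        (s≢c , s≢b) ∷ (s≢a , s≢d) ∷ s∉ , inj₁ (~-sym s~t)
      ... | no s≢c | no s≢d | no _ | yes refl = s , inj₁ refl ,
        (s≢c , s≢b) ∷ (s≢a , s≢d) ∷ s∉ , inj₂ (~-sym s~t)
      ... | no s≢c | no s≢d | no t≢c | no t≢d = ⊥-elim (proj₂ max s~t
        ((s≢c , s≢b) ∷ (s≢a , s≢d) ∷ s∉) ((t≢c , t≢b) ∷ (t≢a , t≢d) ∷ t∉))

      unmatched-neighbour : ∃ λ z → z ∉ᵥ M × (c ~ z ⊎ d ~ z)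
      unmatched-neighbour =
        let (_ , _ , s~t , s∉ , t∉) = extensible G equi mab (proj₁ max) ≤-refl
            (z , _ , z∉ , e) = outlet s~t s∉ t∉
        in z , z∉ , e

      private
        -- Otherwise w-c-b-a-d-z would augment `M`.
        one-sided : ∀ {w z} → c ~ w → d ~ z → w ≢ z → w ∉ᵥ M → z ∉ᵥ M → ⊥
        one-sided c~w d~z w≢z
          ((w≢c , w≢b) ∷ (w≢a , w≢d) ∷ w∉) ((z≢c , z≢b) ∷ (z≢a , z≢d) ∷ z∉) =
          too-long G equi max (cons⁺ G c~w
            ((c≢a , c≢b) ∷ (c≢d , ≢-sym z≢c) ∷ c∉) ((w≢a , w≢b) ∷ (w≢d , w≢z) ∷ w∉)
            (cons⁺ G (~-sym b~a) ((a≢d , ≢-sym z≢a) ∷ a∉) ((b≢d , ≢-sym z≢b) ∷ b∉)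
              (cons⁺ G d~z d∉ z∉ mK))) ≤-refl

      -- Stability at `z₁` provides a second unmatched neighbour of `c`, so `c` is not exposable.
      -- Whatever vertex `z` is in use, an unmatched neighbour of `c` other than `z` remains to
      -- start an augmenting path, and such paths rule out the chords.
      tip-at : ∀ {z₁} → c ~ z₁ → z₁ ∉ᵥ M → Tip c b a d
      tip-at {z₁} c~z₁ z₁∉@((z₁≢c , z₁≢b) ∷ (z₁≢a , z₁≢d) ∷ z₁∉K) = c≁a , b≁d ,
        (z₁ , M , max , z₁∉) , two-unmatched⇒¬exposable equi max z₁≢z₂ c~z₁ c~z₂ z₁∉ z₂∉
        where
        second : ∃ λ z → z₁ ≢ z × c ~ z × z ∉ᵥ M
        second with extensible (isolate G z₁) (proj₂ stable z₁)
          (isolate-matching⁺ G mab ((z₁≢a , z₁≢b) ∷ z₁∉K))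
          (isolate-matching⁺ G (proj₁ max) z₁∉) ≤-refl
        ... | s , t , (s~t , s≢ , t≢) , s∉ , t∉ with outlet s~t s∉ t∉
        ... | z , inj₁ refl , z∉ , inj₁ c~z = z , ≢-sym s≢ , c~z , z∉
        ... | z , inj₂ refl , z∉ , inj₁ c~z = z , ≢-sym t≢ , c~z , z∉
        ... | z , inj₁ refl , z∉ , inj₂ d~z = ⊥-elim (one-sided c~z₁ d~z (≢-sym s≢) z₁∉ z∉)
        ... | z , inj₂ refl , z∉ , inj₂ d~z = ⊥-elim (one-sided c~z₁ d~z (≢-sym t≢) z₁∉ z∉)
        z₂ = proj₁ second
        z₁≢z₂ = proj₁ (proj₂ second)
        c~z₂ = proj₁ (proj₂ (proj₂ second))
        z₂∉ = proj₂ (proj₂ (proj₂ second))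

        avoiding : ∀ z → ∃ λ w → w ≢ z × c ~ w × w ∉ᵥ M
        avoiding z with z ≟ z₁
        ... | yes refl = z₂ , ≢-sym z₁≢z₂ , c~z₂ , z₂∉
        ... | no z≢z₁ = z₁ , ≢-sym z≢z₁ , c~z₁ , z₁∉

        d≁ : ∀ {z} → d ~ z → z ∉ᵥ M → ⊥
        d≁ {z} d~z z∉ with avoiding z
        ... | w , w≢z , c~w , w∉ = one-sided c~w d~z w≢z w∉ z∉

        -- The augmenting path is w-c-b-z.
        b≁ : ∀ {z} → b ~ z → z ∉ᵥ M → ⊥
        b≁ {z} b~z ((z≢c , z≢b) ∷ (z≢a , z≢d) ∷ z∉) with avoiding z
        ... | w , w≢z , c~w , (w≢c , w≢b) ∷ (w≢a , w≢d) ∷ w∉ =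
          too-long G equi max (cons⁺ G c~w
            ((c≢b , ≢-sym z≢c) ∷ (c≢a , c≢d) ∷ c∉) ((w≢b , w≢z) ∷ (w≢a , w≢d) ∷ w∉)
            (cons⁺ G b~z ((b≢a , b≢d) ∷ b∉) ((z≢a , z≢d) ∷ z∉)
              (cons⁺ G a~d a∉ d∉ mK))) ≤-refl

        -- With `d` isolated, `cz₁` and `ab` together with `K` outnumber `cb` with `K`, so some edge
        -- misses the latter. By maximality of `M` that edge contains `a`.
        a-neighbour : ∃ λ z → a ~ z × z ∉ᵥ M
        a-neighbour with extensible (isolate G d) (proj₂ stable d)
          (isolate-matching⁺ G (cons⁺ G c~b c∉ b∉ mK)
            ((≢-sym c≢d , ≢-sym b≢d) ∷ d∉))
          (isolate-matching⁺ G
            (cons⁺ G c~z₁ ((c≢a , c≢b) ∷ c∉) ((z₁≢a , z₁≢b) ∷ z₁∉K) mab)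
            ((≢-sym c≢d , ≢-sym z₁≢d) ∷ (≢-sym a≢d , ≢-sym b≢d) ∷ d∉)) ≤-refl
        ... | s , t , (s~t , s≢d , t≢d) , s∉ ∷ s∉K , t∉ ∷ t∉K with s ≟ a | t ≟ a
        ... | yes refl | _ = t , s~t , t∉ ∷ (≢-sym (~⇒≢ G s~t) , t≢d) ∷ t∉K
        ... | no _ | yes refl = s , ~-sym s~t , s∉ ∷ (~⇒≢ G s~t , s≢d) ∷ s∉K
        ... | no s≢a | no t≢a =
          ⊥-elim (proj₂ max s~t (s∉ ∷ (s≢a , s≢d) ∷ s∉K) (t∉ ∷ (t≢a , t≢d) ∷ t∉K))

        -- The chord would give the augmenting path w-c-b-d-a-z.
        b≁d : ¬ b ~ d
        b≁d b~d with a-neighbour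
        ... | z , a~z , (z≢c , z≢b) ∷ (z≢a , z≢d) ∷ z∉ with avoiding z
        ... | w , w≢z , c~w , (w≢c , w≢b) ∷ (w≢a , w≢d) ∷ w∉ =
          too-long G equi max (cons⁺ G c~w
            ((c≢b , c≢d) ∷ (c≢a , ≢-sym z≢c) ∷ c∉) ((w≢b , w≢d) ∷ (w≢a , w≢z) ∷ w∉)
            (cons⁺ G b~d ((b≢a , ≢-sym z≢b) ∷ b∉) ((≢-sym a≢d , ≢-sym z≢d) ∷ d∉)
              (cons⁺ G a~z a∉ z∉ mK))) ≤-refl

        -- With this chord, `ca` and `K` would form a matching shorter than `M`. An edge extending
        -- it would be `bd`, or join `b` or `d` to an unmatched vertex, or miss `M` altogether.
        c≁a : ¬ c ~ a
        c≁a c~a with extensible G equi (cons⁺ G c~a c∉ a∉ mK) (proj₁ max) ≤-refl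
        ... | s , t , s~t , (s≢c , s≢a) ∷ s∉ , (t≢c , t≢a) ∷ t∉
          with s ≟ b | s ≟ d | t ≟ b | t ≟ d
        ... | yes refl | _ | _ | yes refl = b≁d s~t
        ... | yes refl | _ | _ | no t≢d =
          b≁ s~t ((t≢c , ≢-sym (~⇒≢ G s~t)) ∷ (t≢a , t≢d) ∷ t∉)
        ... | no _ | yes refl | yes refl | _ = b≁d (~-sym s~t)
        ... | no _ | yes refl | no t≢b | _ =
          d≁ s~t ((t≢c , t≢b) ∷ (t≢a , ≢-sym (~⇒≢ G s~t)) ∷ t∉)
        ... | no s≢b | no s≢d | yes refl | _ =
          b≁ (~-sym s~t) ((s≢c , s≢b) ∷ (s≢a , s≢d) ∷ s∉)
        ... | no s≢b | no s≢d | no _ | yes refl =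
          d≁ (~-sym s~t) ((s≢c , s≢b) ∷ (s≢a , s≢d) ∷ s∉)
        ... | no s≢b | no s≢d | no t≢b | no t≢d = proj₂ max s~t
          ((s≢c , s≢b) ∷ (s≢a , s≢d) ∷ s∉) ((t≢c , t≢b) ∷ (t≢a , t≢d) ∷ t∉)

    -- In a maximal matching containing `cb` and `ad`, one end of the path has an unmatched
    -- neighbour; that end is the tip.
    openPath-tip : ∀ {c b a d} → c ~ b → b ~ a → a ~ d → c ≢ a → b ≢ d → c ≢ d → ¬ c ~ d →
      Tip c b a d ⊎ Tip d a b c
    openPath-tip {c} {b} {a} {d} c~b b~a a~d c≢a b≢d c≢d c≁d
      with extend G (cons⁺ G c~b ((c≢a , c≢d) ∷ []) ((~⇒≢ G b~a , b≢d) ∷ [])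
        (cons⁺ G a~d [] [] ([] , [])))
    ... | L , maxL with max-resp-↭ G (↭-trans (↭-shift L _) (↭-prep _ (↭-shift L []))) maxL
    ... | max with unmatched-neighbour max b~a c≁d
    ... | z , z∉ , inj₁ c~z = inj₁ (tip-at max b~a c≁d c~z z∉)
    ... | z , z∉ , inj₂ d~z =
      inj₂ (tip-at (max-resp-↭ G reversed max) (~-sym b~a) (c≁d ∘ ~-sym) d~z
        (∉ᵥ-resp-↭ reversed z∉))
      where
      reversed : ∀ {K} → (c , b) ∷ (a , d) ∷ K ↭ (d , a) ∷ (b , c) ∷ K
      reversed = swap flip flip ↭-refl

    path-with-chord : ∀ {c b a d} → c ~ b → b ~ a → a ~ d → c ≢ a → b ≢ d → c ≢ d →
      b ~ d → c ~ d
    path-with-chord {c} {d = d} c~b b~a a~d c≢a b≢d c≢d b~d =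
      decidable-stable (c ~? d) λ c≁d →
        [ (λ (_ , b≁d , _) → b≁d b~d) , (λ (d≁b , _) → d≁b (~-sym b~d)) ]
        (openPath-tip c~b b~a a~d c≢a b≢d c≢d c≁d)

-- Triangles in vertex-stable graphs

module _ {n : ℕ} (G : Graph n) where
  open Graph G

  TriangleFree : Set
  TriangleFree = ∀ {a b c} → a ~ b → b ~ c → c ~ a → ⊥

  module _ (stable : VertexStable G) where

    private
      equi = proj₁ stable

    -- For a triangle `w`, `p`, `q`, a neighbour `v` of `w` other than `p` and `q` is adjacent to
    -- `p`, by the path v-w-q-p with chord `wp`. So triangles spread to every vertex, and distinct
    -- neighbours of a vertex become adjacent.
    triangle⇒complete : Connected G → ∀ {a b c} → a ~ b → b ~ c → c ~ a → Complete G
    triangle⇒complete conn {a} {b} {c} a~b b~c c~a u v u≢v with joined (conn u v)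
      where
      step : ∀ {v w p q} → v ~ w → w ~ p → p ~ q → q ~ w → v ≡ p ⊎ v ~ p
      step {v} {w} {p} {q} v~w w~p p~q q~w with v ≟ p | v ≟ q
      ... | yes v≡p | _ = inj₁ v≡p
      ... | no _ | yes refl = inj₂ (~-sym p~q)
      ... | no v≢p | no v≢q = inj₂
        (path-with-chord G stable v~w (~-sym q~w) (~-sym p~q) v≢q (~⇒≢ G w~p) v≢p w~p)

      inTriangle : ∀ {v} → Star _~_ v a → ∃₂ λ p q → v ~ p × p ~ q × q ~ v
      inTriangle ε = b , c , a~b , b~c , c~a
      inTriangle {v} (_◅_ {j = w} v~w s) with inTriangle s
      ... | p , q , w~p , p~q , q~w with step v~w w~p p~q q~w
      ... | inj₁ refl = q , w , p~q , q~w , w~p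
      ... | inj₂ v~p = w , p , v~w , w~p , ~-sym v~p

      ~-trans : ∀ {u w v} → u ~ w → w ~ v → u ≢ v → u ~ v
      ~-trans {u} {w} {v} u~w w~v u≢v with inTriangle (conn w a)
      ... | p , q , w~p , p~q , q~w
        with step u~w w~p p~q q~w | step (~-sym w~v) w~p p~q q~w
      ... | inj₁ refl | inj₁ refl = ⊥-elim (u≢v refl)
      ... | inj₁ refl | inj₂ v~u = ~-sym v~u
      ... | inj₂ u~v | inj₁ refl = u~v
      ... | inj₂ u~p | inj₂ v~p = ~-sym (path-with-chord G stable
        v~p (~-sym w~p) (~-sym u~w) (~⇒≢ G (~-sym w~v)) (~⇒≢ G (~-sym u~p)) (≢-sym u≢v)
        (~-sym u~p))

      joined : ∀ {u v} → Star _~_ u v → u ≡ v ⊎ u ~ v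
      joined ε = inj₁ refl
      joined {u} {v} (u~w ◅ s) with u ≟ v | joined s
      ... | yes u≡v | _ = inj₁ u≡v
      ... | no _ | inj₁ refl = inj₂ u~w
      ... | no u≢v | inj₂ w~v = inj₂ (~-trans u~w w~v u≢v)
    ... | inj₁ u≡v = ⊥-elim (u≢v u≡v)
    ... | inj₂ u~v = u~v

    -- Exposability as a bipartition

    module _ (triangleFree : TriangleFree) where

      -- If p₂ is the vertex two steps after p on the alternating path of M and N
      -- starting at p, then y-p-p₁-p₂ closes up, so p may be replaced by p₂.
      disjoint-exposures : ∀ k K M N {p y} → length M ≡ k → Max G (K ++ M) → Max G (K ++ N) →
        p ∉ᵥ K ++ M → y ∉ᵥ K ++ N → p ~ y → ⊥
      disjoint-exposures k K M N {p} {y} eq maxM maxN p∉ y∉ p~y with p ∉ᵥ? K ++ N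
      ... | yes p∉N = proj₂ maxN p~y p∉N y∉
      ... | no p∈N with mate-in-tail K N (++⁻ˡ K p∉) p∈N
      ... | p₁ , N′ , N↭ , _ with cons⁻ G (proj₁ (max-resp-↭ G N↭ maxN))
      ... | p~p₁ , _ , p₁∉N′ , _ with p₁ ∉ᵥ? K ++ M
      ... | yes p₁∉M = proj₂ maxM p~p₁ p∉ p₁∉M
      ... | no p₁∈M with mate-in-tail K M (++⁻ˡ K p₁∉N′) p₁∈M
      ... | p₂ , M′ , M↭ , len with k | trans (sym len) eq
      ... | suc k′ | eq′
        with rotate G equi (max-resp-↭ G (↭-trans M↭ (prep flip ↭-refl)) maxM) (~-sym p~p₁)
               (∉ᵥ-resp-↭ (↭-trans M↭ (prep flip ↭-refl)) p∉)
           | y ≟ p₂ | ∉ᵥ-resp-↭ N↭ y∉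
      ... | _ | yes refl | _ =
        triangleFree p~p₁ (proj₁ (cons⁻ G (proj₁ (max-resp-↭ G M↭ maxM)))) (~-sym p~y)
      ... | maxM′ , p₂∉ | no y≢p₂ | y∉′@((_ , y≢p₁) ∷ _)
        with max-resp-↭ G (prep flip ↭-refl) maxM′ | ∉ᵥ-resp-↭ (prep flip ↭-refl) p₂∉
      ... | maxM″ | p₂∉′@((p₂≢p , _) ∷ _) =
        disjoint-exposures k′ ((p , p₁) ∷ K) M′ N′ (suc-injective eq′) maxM″
          (max-resp-↭ G N↭ maxN) p₂∉′ y∉′ (~-sym y~p₂)
        where
        y~p₂ : y ~ p₂
        y~p₂ = decidable-stable (y ~? p₂) λ y≁p₂ →
          [ (λ (_ , _ , _ , ¬exp) → ¬exp (_ , maxN , y∉))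
          , (λ (_ , _ , _ , ¬exp) → ¬exp (_ , maxM″ , p₂∉′))
          ] (openPath-tip G stable (~-sym p~y) p~p₁
              (proj₁ (cons⁻ G (proj₁ (max-resp-↭ G M↭ maxM)))) y≢p₁ (≢-sym p₂≢p) y≢p₂ y≁p₂)

      exposable-independent : ∀ {u v} → u ~ v → Exposable G u → Exposable G v → ⊥
      exposable-independent u~v (M , maxM , u∉) (N , maxN , v∉) =
        disjoint-exposures _ [] M N refl maxM maxN u∉ v∉ u~v

    -- For xq and yy′ in a maximal matching missing p, replacing them by xy cannot
    -- give a maximal matching of G - q, since replacing xq by xp gives a larger one.
    exposable-neighbour : ∀ {p x y} → p ~ x → x ~ y → Exposable G p → ¬ Exposable G x →
      Exposable G y
    exposable-neighbour {p} {x} {y} p~x x~y (M , maxM , p∉) x∉D with x ∉ᵥ? M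
    ... | yes x∉ = ⊥-elim (x∉D (M , maxM , x∉))
    ... | no x∈ with mate M x∈
    ... | q , M₁ , M↭ with max-resp-↭ G M↭ maxM | ∉ᵥ-resp-↭ M↭ p∉ | y ≟ q
    ... | max₁ | p∉₁ | yes refl = (x , p) ∷ M₁ , rotate G equi
      (max-resp-↭ G (prep flip ↭-refl) max₁) (~-sym p~x) (∉ᵥ-resp-↭ (prep flip ↭-refl) p∉₁)
    ... | max₁ | p∉₁ | no y≢q with y ∉ᵥ? M₁
    ... | yes y∉ = _ , max₁ , (≢-sym (~⇒≢ G x~y) , y≢q) ∷ y∉
    ... | no y∈ with mate M₁ y∈
    ... | y′ , R , M₁↭ with max-resp-↭ G (↭-prep _ M₁↭) max₁ | ∉ᵥ-resp-↭ (↭-prep _ M₁↭) p∉₁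
    ... | max | (p≢x , p≢q) ∷ (p≢y , p≢y′) ∷ p∉R with cons⁻ G (proj₁ max)
    ... | x~q , (x≢y , x≢y′) ∷ x∉R , q∉@((_ , q≢y′) ∷ q∉R) , m with cons⁻ G m
    ... | y~y′ , y∉R , y′∉R , mR
      with extensible (isolate G q) (proj₂ stable q)
        (isolate-matching⁺ G (cons⁺ G x~y x∉R y∉R mR)
          ((≢-sym (~⇒≢ G x~q) , ≢-sym y≢q) ∷ q∉R))
        (isolate-matching⁺ G
          (cons⁺ G (~-sym p~x) ((x≢y , x≢y′) ∷ x∉R) ((p≢y , p≢y′) ∷ p∉R) m)
          ((≢-sym (~⇒≢ G x~q) , ≢-sym p≢q) ∷ q∉)) ≤-refl
    ... | s , t , (s~t , s≢q , t≢q) , (s≢x , s≢y) ∷ s∉ , (t≢x , t≢y) ∷ t∉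
      with s ≟ y′ | t ≟ y′
    ... | yes refl | _ = _ , rotate G equi (max-resp-↭ G (↭-swap _ _ ↭-refl) max) s~t
      ((t≢y , ≢-sym (~⇒≢ G s~t)) ∷ (t≢x , t≢q) ∷ t∉)
    ... | no _ | yes refl = _ , rotate G equi (max-resp-↭ G (↭-swap _ _ ↭-refl) max) (~-sym s~t)
      ((s≢y , ~⇒≢ G s~t) ∷ (s≢x , s≢q) ∷ s∉)
    ... | no s≢y′ | no t≢y′ = ⊥-elim (proj₂ max s~t
      ((s≢x , s≢q) ∷ (s≢y , s≢y′) ∷ s∉) ((t≢x , t≢q) ∷ (t≢y , t≢y′) ∷ t∉))

    -- A maximal matching `N` after the deletion is maximal in `G` unless it misses both `u` and
    -- `v`. In that case let `w` be an exposable end and `M` a maximal matching missing it: adding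
    -- `uv` to `N` shows that `N` is shorter than `M`, yet `N` is maximal in `G` with `w` isolated,
    -- where `M` is a matching.
    exposable-edge⇒equi-deleteEdge : ∀ {u v} → u ~ v → Exposable G u ⊎ Exposable G v →
      Equi (deleteEdge G (u , v))
    exposable-edge⇒equi-deleteEdge {u} {v} u~v exp M N maxM maxN =
      equi M N (max-deleteEdge maxM) (max-deleteEdge maxN)
      where
      max-deleteEdge : ∀ {N} → Max (deleteEdge G (u , v)) N → Max G N
      max-deleteEdge {N} ((es , ds) , max) = mN , λ {s} {t} s~t s∉ t∉ →
        max (s~t , λ { same → both s∉ t∉ ; flip → both t∉ s∉ }) s∉ t∉
        where
        mN : IsMatching G N
        mN = All.map proj₁ es , ds

        both : u ∉ᵥ N → v ∉ᵥ N → ⊥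
        both u∉ v∉ = [ clash u∉ (λ { p _ same → p refl ; _ q flip → q refl })
                     , clash v∉ (λ { _ q same → q refl ; p _ flip → p refl }) ] exp
          where
          clash : ∀ {w} → w ∉ᵥ N → (∀ {s t} → s ≢ w → t ≢ w → ¬ SameEdge (s , t) (u , v)) →
            Exposable G w → ⊥
          clash {w} w∉ avoid (M , maxM , w∉M) =
            too-long (isolate G w) (proj₂ stable w)
              (isolate-matching⁺ G mN w∉ , λ (e , p , q) → max (e , avoid p q))
              (isolate-matching⁺ G (proj₁ maxM) w∉M)
              (≰⇒> λ M≤N → too-long G equi maxM (cons⁺ G u~v u∉ v∉ mN) (s≤s M≤N))

    exposable⇒bipartite-edgeStable : TriangleFree → Connected G → ∃ (Exposable G) →
      Bipartite G × EdgeStableEquimatchable G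
    exposable⇒bipartite-edgeStable triangleFree conn (r , exp-r) =
      (side , bipartite) ,
      equi⇒equimatchable G equi ,
      λ u v u~v → equi⇒equimatchable (deleteEdge G (u , v))
        (exposable-edge⇒equi-deleteEdge u~v (covered u~v))
      where
      -- The second case carries an exposable neighbour so that `exposable-neighbour` can be applied
      -- at the next vertex.
      Side : Fin n → Set
      Side v = Exposable G v ⊎ (¬ Exposable G v × ∃ λ p → v ~ p × Exposable G p)

      classify : ∀ {v} → Star _~_ v r → Side v
      classify ε = inj₁ exp-r
      classify (v~w ◅ s) with classify s
      ... | inj₁ exp-w =
        inj₂ ((λ exp-v → exposable-independent triangleFree v~w exp-v exp-w) , _ , v~w , exp-w)
      ... | inj₂ (¬exp-w , _ , w~p , exp-p) =
        inj₁ (exposable-neighbour (~-sym w~p) (~-sym v~w) exp-p ¬exp-w)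

      isExposable : ∀ {v} → Side v → Bool
      isExposable = [ (λ _ → true) , (λ _ → false) ]

      side : Fin n → Bool
      side v = isExposable (classify (conn v r))

      -- The classifications are arbitrary, since those of `u` and `v` come from unrelated walks to
      -- `r`.
      ends-differ : ∀ {u v} → u ~ v → (p : Side u) (q : Side v) →
        isExposable p ≢ isExposable q
      ends-differ u~v (inj₁ p) (inj₁ q) _ = exposable-independent triangleFree u~v p q
      ends-differ u~v (inj₂ (¬p , _ , u~w , exp-w)) (inj₂ (¬q , _)) _ =
        ¬q (exposable-neighbour (~-sym u~w) u~v exp-w ¬p)

      bipartite : ∀ u v → u ~ v → side u ≢ side v
      bipartite u v u~v = ends-differ u~v (classify (conn u r)) (classify (conn v r))

      covered : ∀ {u v} → u ~ v → Exposable G u ⊎ Exposable G v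
      covered {u} {v} u~v with classify (conn u r)
      ... | inj₁ exp-u = inj₁ exp-u
      ... | inj₂ (¬exp-u , _ , u~w , exp-w) =
        inj₂ (exposable-neighbour (~-sym u~w) u~v exp-w ¬exp-u)

  -- Triangle-free graphs whose four-vertex paths close up

  p₄Closed⇒completeBipartite-from : Fin n → Connected G → TriangleFree → P₄Closed G →
    CompleteBipartite G
  p₄Closed⇒completeBipartite-from r conn triangleFree closed = side , λ u v → mk⇔ (to u v) (from u v)
    where
    side : Fin n → Bool
    side v = does (v ~? r)

    -- A path of three edges ending at `r` closes up, so distances to `r` never exceed two.
    near : ∀ {v} → Star _~_ v r → v ≡ r ⊎ v ~ r ⊎ ∃ λ w → v ~ w × w ~ r
    near ε = inj₁ refl
    near {v} (_◅_ {j = w} v~w s) with near s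
    ... | inj₁ refl = inj₂ (inj₁ v~w)
    ... | inj₂ (inj₁ w~r) = inj₂ (inj₂ (_ , v~w , w~r))
    ... | inj₂ (inj₂ (x , w~x , x~r)) with v ≟ r | v ≟ x | w ≟ r
    ... | yes v≡r | _ | _ = inj₁ v≡r
    ... | no _ | yes refl | _ = inj₂ (inj₁ x~r)
    ... | no _ | no _ | yes refl = inj₂ (inj₁ v~w)
    ... | no v≢r | no v≢x | no w≢r = inj₂ (inj₁ (closed v~w w~x x~r v≢x w≢r v≢r))

    to : ∀ u v → u ~ v → side u ≢ side v
    to u v u~v with u ~? r | v ~? r
    ... | yes u~r | yes v~r = λ _ → triangleFree u~v v~r (~-sym u~r)
    ... | yes _ | no _ = λ ()
    ... | no _ | yes _ = λ ()
    ... | no u≁r | no v≁r with near (conn u r)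
    ...   | inj₁ refl = ⊥-elim (v≁r (~-sym u~v))
    ...   | inj₂ (inj₁ u~r) = ⊥-elim (u≁r u~r)
    -- The path v-u-w-r closes up and makes `v` a neighbour of `r`.
    ...   | inj₂ (inj₂ (w , u~w , w~r)) = ⊥-elim (v≁r (closed (~-sym u~v) u~w w~r
      (λ { refl → v≁r w~r }) (λ { refl → v≁r (~-sym u~v) }) (λ { refl → u≁r u~v })))

    across : ∀ {u v} → u ~ r → ¬ v ~ r → v ~ u
    across {u} {v} u~r v≁r with near (conn v r)
    ... | inj₁ refl = ~-sym u~r
    ... | inj₂ (inj₁ v~r) = ⊥-elim (v≁r v~r)
    ... | inj₂ (inj₂ (w , v~w , w~r)) with w ≟ u | v ≟ r
    ...   | yes refl | _ = v~w
    ...   | no _ | yes refl = ~-sym u~r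
    ...   | no w≢u | no v≢r =
      closed v~w w~r (~-sym u~r) v≢r w≢u (λ { refl → v≁r u~r })

    from : ∀ u v → side u ≢ side v → u ~ v
    from u v u≢v with u ~? r | v ~? r
    ... | yes _ | yes _ = ⊥-elim (u≢v refl)
    ... | no _ | no _ = ⊥-elim (u≢v refl)
    ... | yes u~r | no v≁r = ~-sym (across u~r v≁r)
    ... | no u≁r | yes v~r = across v~r u≁r

p₄Closed⇒completeBipartite : ∀ (G : Graph n) → Connected G → TriangleFree G → P₄Closed G →
  CompleteBipartite G
p₄Closed⇒completeBipartite {zero} _ _ _ _ = (λ ()) , λ ()
p₄Closed⇒completeBipartite {suc n} G = p₄Closed⇒completeBipartite-from G zero

-- Case distinction on triangles and open paths

module _ {n : ℕ} (G : Graph n) where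
  open Graph G

  triangle? : Dec (∃[ a ] ∃[ b ] ∃[ c ] a ~ b × b ~ c × c ~ a)
  triangle? = any? λ a → any? λ b → any? λ c → (a ~? b) ×-dec (b ~? c) ×-dec (c ~? a)

  openPath? : Dec (∃[ c ] ∃[ b ] ∃[ a ] ∃[ d ]
    c ~ b × b ~ a × a ~ d × c ≢ a × b ≢ d × c ≢ d × ¬ c ~ d)
  openPath? = any? λ c → any? λ b → any? λ a → any? λ d →
    (c ~? b) ×-dec (b ~? a) ×-dec (a ~? d) ×-dec
    ¬? (c ≟ a) ×-dec ¬? (b ≟ d) ×-dec ¬? (c ≟ d) ×-dec ¬? (c ~? d)

  vertexStable⇒ : Connected G → VertexStable G →
    Complete G ⊎ CompleteBipartite G ⊎ (Bipartite G × EdgeStableEquimatchable G)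
  vertexStable⇒ conn stable with triangle? | openPath?
  ... | yes (_ , _ , _ , a~b , b~c , c~a) | _ =
    inj₁ (triangle⇒complete G stable conn a~b b~c c~a)
  ... | no noTriangle | no noOpenPath = inj₂ (inj₁ (p₄Closed⇒completeBipartite G conn
    (λ p q r → noTriangle (_ , _ , _ , p , q , r))
    (λ {c} {_} {_} {d} p q r s t u → decidable-stable (c ~? d) λ c≁d →
      noOpenPath (_ , _ , _ , _ , p , q , r , s , t , u , c≁d))))
  -- The open path supplies an exposable vertex, the starting point of the bipartition.
  ... | no noTriangle | yes (_ , _ , _ , _ , p , q , r , s , t , u , c≁d) =
    inj₂ (inj₂ (exposable⇒bipartite-edgeStable G stable
      (λ p q r → noTriangle (_ , _ , _ , p , q , r)) conn
      ([ exposed , exposed ] (openPath-tip G stable p q r s t u c≁d))))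
    where
    exposed : ∀ {c b a d} → Tip G stable c b a d → ∃ (Exposable G)
    exposed (_ , _ , exp , _) = exp

  vertexStable⇐ : Complete G ⊎ CompleteBipartite G ⊎ (Bipartite G × EdgeStableEquimatchable G) →
    VertexStable G
  vertexStable⇐ (inj₁ complete) =
    p₄Closed⇒vertexStable G (complete⇒p₄Closed G complete)
  vertexStable⇐ (inj₂ (inj₁ bip)) =
    p₄Closed⇒vertexStable G (completeBipartite⇒p₄Closed G bip)
  vertexStable⇐ (inj₂ (inj₂ (bip , equi , stable))) =
    equimatchable⇒equi G equi ,
    bipartite-edgeStable⇒equi-isolate G (equimatchable⇒equi G equi) bip
      λ u v u~v → equimatchable⇒equi (deleteEdge G (u , v)) (stable u v u~v)

theorem7p6 : ∀ {n} (G : Graph n) → Connected G →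
    VertexStableEquimatchable G ⇔
    (Complete G ⊎ CompleteBipartite G ⊎ (Bipartite G × EdgeStableEquimatchable G))
theorem7p6 G conn = mk⇔
  (vertexStable⇒ G conn ∘ vertexStable⁺ G)
  (vertexStable⁻ G ∘ vertexStable⇐ G)
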